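{- Let $p$ be a prime and let $G$ be a finite elementary abelian $p$-group (written additively) with exponent $e(G)=p$. Let $D\subseteq G$ be a subset with $|D|=|G|-c\geq c$, let $b\in G$, and let $k$ be an integer with $0\le k\le |D|$. Let $N(D,k,b)$ be the number of $k$-element subsets $S\subseteq D$ such that $\sum_{x\in S}x=b$. Then $$\left| N(D, k, b)-\frac{1}{|G|}\binom{|G|-c}{k}\right|\leq \binom{\frac{|G|-2c}{p}+c+k-1}{k}.$$
   Context: For a real number $x$ and an integer $k\ge 0$, $\binom{x}{k}=\frac{(x)_k}{k!}$ with $(x)_0=1$ and $(x)_k=x(x-1)\cdots(x-k+1)$ for $k\geq 1$. -}

module Defs where

open import Algebra.Bundles using (AbelianGroup)
import Algebra.Definitions.RawMonoid as RawMonoidDefs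
open import Data.Bool.Base using (if_then_else_)
open import Data.Fin.Base using (Fin)
open import Data.Fin.Properties as Finₚ using (nonZeroIndex)
open import Data.Fin.Subset using (Subset; inside; outside; _⊆_; ∣_∣)
open import Data.Fin.Subset.Properties using (_⊆?_)
open import Data.Integer.Base using (+_)
open import Data.List.Base using (List; []; _∷_; _++_; map; filter; length)
open import Data.Nat.Base as ℕ using (ℕ; zero; suc; NonZero; _!)
import Data.Nat.Properties as ℕₚ
open import Data.Product.Base using (_×_)
open import Data.Rational.Base as ℚ using (ℚ; 1ℚ; _/_)
open import Data.Vec.Base as Vec using (lookup)
open import Function.Bundles using (Inverse)
open import Function.Properties.Inverse using (Inverse⇒Injection)
open import Level using (_⊔_) renaming (suc to lsuc)
open import Relation.Binary.Definitions using (Decidable)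
open import Relation.Binary.PropositionalEquality using (_≡_; setoid)
open import Relation.Nullary.Decidable using (via-injection; _×-dec_)
open import Relation.Nullary.Negation using (¬_)
import Relation.Unary as Pred

ℕ→ℚ : ℕ → ℚ
ℕ→ℚ n = + n / 1

-- (x)ₖ = x (x - 1) ⋯ (x - k + 1)
fallingFactorial : ℚ → ℕ → ℚ
fallingFactorial x zero    = 1ℚ
fallingFactorial x (suc k) = fallingFactorial x k ℚ.* (x ℚ.- ℕ→ℚ k)

-- Generalised binomial coefficient.  The upper argument ranges over ℚ
-- rather than ℝ: only rational upper arguments are ever used.
binomial : ℚ → ℕ → ℚ
binomial x k = fallingFactorial x k ℚ.* (+ 1 / k !) {{ k ℕₚ.!≢0 }}

-- Every subset of Fin n, each listed exactly once.
subsets : ∀ n → List (Subset n)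
subsets zero    = Vec.[] ∷ []
subsets (suc n) = map (outside Vec.∷_) (subsets n) ++ map (inside Vec.∷_) (subsets n)

-- An abelian group with a chosen enumeration of its elements.  A subset of
-- the group is then a  Subset order : the i-th entry says whether the i-th
-- element belongs to it.
record FiniteAbelianGroup a ℓ : Set (lsuc (a ⊔ ℓ)) where
  field
    abelianGroup : AbelianGroup a ℓ
    order        : ℕ
    enumeration  : Inverse (AbelianGroup.setoid abelianGroup) (setoid (Fin order))

  open AbelianGroup abelianGroup public hiding (setoid)
  open RawMonoidDefs rawMonoid public using (sum) renaming (_×_ to _·_)

  element : Fin order → Carrier
  element = Inverse.from enumeration

  _≈?_ : Decidable _≈_
  _≈?_ = via-injection (Inverse⇒Injection enumeration) Finₚ._≟_

  instance
    order-nonZero : NonZero order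
    order-nonZero = nonZeroIndex (Inverse.to enumeration ε)

  HasOrder : Carrier → ℕ → Set ℓ
  HasOrder x m = 0 ℕ.< m × m · x ≈ ε × (∀ j → 0 ℕ.< j → j · x ≈ ε → m ℕ.≤ j)

  IsElementaryAbelian : ℕ → Set (a ⊔ ℓ)
  IsElementaryAbelian p = ∀ x → ¬ (x ≈ ε) → HasOrder x p

  -- In particular, having a prime exponent excludes the trivial group,
  -- whose exponent is 1.
  HasExponent : ℕ → Set (a ⊔ ℓ)
  HasExponent m =
    0 ℕ.< m × (∀ x → m · x ≈ ε) × (∀ j → 0 ℕ.< j → (∀ x → j · x ≈ ε) → m ℕ.≤ j)

  subsetSum : Subset order → Carrier
  subsetSum S = sum λ i → if lookup S i then element i else ε

  IsSolution : Subset order → ℕ → Carrier → Subset order → Set ℓ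
  IsSolution D k b S = S ⊆ D × ∣ S ∣ ≡ k × subsetSum S ≈ b

  isSolution? : ∀ D k b → Pred.Decidable (IsSolution D k b)
  isSolution? D k b S = (S ⊆? D) ×-dec (∣ S ∣ ℕₚ.≟ k) ×-dec (subsetSum S ≈? b)

  N : Subset order → ℕ → Carrier → ℕ
  N D k b = length (filter (isSolution? D k b) (subsets order))

{-# OPTIONS --safe #-}

-- Over the group ring, the numbers N(D, k, b) are the coefficients of
-- ∏ (1 + z x), x ∈ D.  Replacing the coefficient of z⁰ by its deviation δ - 1/|G|
-- from the mean turns N(D, k, b) into f k b = N(D, k, b) - binom(|D|, k)/|G|, and
-- every f k then has zero sum over G.  Newton's identities express k (f k b) as
-- ∑ᵢ (-1)ⁱ⁻¹ ∑_{x ∈ D} f (k - i) (b - i x).  If p ∤ i, then x ↦ b - i x permutes G,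
-- so D may be replaced by its complement and the inner sum has absolute value at
-- most c max |f (k - i)|; if p ∣ i it is |D| f (k - i) b.  The bound
-- B k = binom(s + k - 1, k) with s = (|G| - 2c)/p + c satisfies
-- k B k = s (B 0 + ⋯ + B (k - 1)) and is nondecreasing because s ≥ 1, so |f k| ≤ B k
-- follows by strong induction on k.

module Submission where

open import Defs
open import Algebra.Bundles using (AbelianGroup; CommutativeMonoid)
import Algebra.Definitions.RawMonoid as RawMonoidDefs
import Algebra.Properties.CommutativeMonoid.Sum as CommutativeMonoidSum
open import Data.Bool.Base using (true; false; if_then_else_)
open import Data.Fin.Base using (Fin; zero; suc)
open import Data.Fin.Permutation using (Permutation′)
import Data.Fin.Properties as Finₚ
open import Data.Fin.Subset using (Subset; inside; outside; ∁; _⊆_; _∉_; ∣_∣)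
open import Data.Fin.Subset.Properties using (_⊆?_; drop-∷-⊆; out⊆; s⊆s; ∣∁p∣≡n∸∣p∣)
open import Data.Integer.Base as ℤ using (+_)
import Data.Integer.Properties as ℤₚ
import Data.Integer.Tactic.RingSolver as ℤ-Solver
open import Data.List.Base using ([]; _∷_; filter; length; map)
open import Data.List.Properties using (filter-++; filter-≐; filter-none; length-++)
import Data.List.Relation.Unary.All as All
open import Data.Nat.Base as ℕ using (ℕ; zero; suc; _!)
open import Data.Nat.Coprimality using (prime⇒coprime; coprime-Bézout)
open import Data.Nat.GCD using (module Bézout)
open import Data.Nat.Induction using (<-rec)
open import Data.Nat.Primality using (Prime; prime⇒nonZero)
import Data.Nat.Properties as ℕₚ
open import Data.Product.Base using (_×_; _,_; ∃)
open import Data.Rational.Base as ℚ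
  using (ℚ; 0ℚ; 1ℚ; _/_; _+_; _*_; _-_; -_; _≤_; nonNegative; toℚᵘ) renaming (∣_∣ to ∥_∥)
import Data.Rational.Properties as ℚₚ
open import Data.Rational.Unnormalised.Base as ℚᵘ using (mkℚᵘ; *≡*)
import Data.Rational.Unnormalised.Properties as ℚᵘₚ
open import Data.Sum.Base using (_⊎_; inj₁; inj₂)
open import Data.Vec.Base using ([]; _∷_; lookup; here)
open import Function.Base using (_∘_; id)
open import Function.Bundles using (Inverse; mk↔ₛ′)
open import Level using (0ℓ; _⊔_)
open import Relation.Binary.Definitions using (Decidable)
open import Relation.Binary.PropositionalEquality
  using (_≡_; _≢_; refl; sym; trans; cong; cong₂; module ≡-Reasoning)
import Relation.Binary.Reasoning.Setoid as SetoidReasoning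
open import Relation.Nullary.Decidable using (does; yes; no; _×-dec_; dec⇒maybe)
open import Relation.Nullary.Negation using (¬_; contradiction)
import Relation.Unary as Pred
open import Tactic.RingSolver using (solve-∀)
open import Tactic.RingSolver.Core.AlmostCommutativeRing using (AlmostCommutativeRing; fromCommutativeRing)

-- Rational arithmetic and the embedding of the natural numbers

ℚ-ring : AlmostCommutativeRing 0ℓ 0ℓ
ℚ-ring = fromCommutativeRing ℚₚ.+-*-commutativeRing (λ x → dec⇒maybe (0ℚ ℚₚ.≟ x))

-- Bridge to unnormalised fractions, where equality is cross multiplication; the identities for
-- `ℕ→ℚ` below are checked there and carried back by injectivity.
toℚᵘ-/ : ∀ i d → toℚᵘ (i / suc d) ℚᵘ.≃ mkℚᵘ i d
toℚᵘ-/ i d = ℚₚ.toℚᵘ-fromℚᵘ (mkℚᵘ i d)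

ℕ→ℚ-+ : ∀ m n → ℕ→ℚ (m ℕ.+ n) ≡ ℕ→ℚ m + ℕ→ℚ n
ℕ→ℚ-+ m n = ℚₚ.toℚᵘ-injective (begin
  toℚᵘ (ℕ→ℚ (m ℕ.+ n))              ≈⟨ toℚᵘ-/ (+ (m ℕ.+ n)) 0 ⟩
  mkℚᵘ (+ (m ℕ.+ n)) 0              ≈⟨ *≡* (cong (ℤ._* + 1) (sym (cong₂ ℤ._+_ (ℤₚ.*-identityʳ (+ m)) (ℤₚ.*-identityʳ (+ n))))) ⟩
  mkℚᵘ (+ m) 0 ℚᵘ.+ mkℚᵘ (+ n) 0    ≈⟨ ℚᵘₚ.+-cong (toℚᵘ-/ (+ m) 0) (toℚᵘ-/ (+ n) 0) ⟨
  toℚᵘ (ℕ→ℚ m) ℚᵘ.+ toℚᵘ (ℕ→ℚ n)    ≈⟨ ℚₚ.toℚᵘ-homo-+ (ℕ→ℚ m) (ℕ→ℚ n) ⟨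
  toℚᵘ (ℕ→ℚ m + ℕ→ℚ n)              ∎)
  where open ℚᵘₚ.≃-Reasoning

ℕ→ℚ-suc : ∀ n → ℕ→ℚ (suc n) ≡ 1ℚ + ℕ→ℚ n
ℕ→ℚ-suc = ℕ→ℚ-+ 1

-- A single cross-multiplication rule that later yields the recurrence for `1/k!`, the identity
-- `n * (1/n) = 1`, and `p * (m/p) = m`.
ℕ→ℚ-*-/ : ∀ m n l d e .{{_ : ℕ.NonZero d}} .{{_ : ℕ.NonZero e}} →
          m ℕ.* n ℕ.* e ≡ l ℕ.* d → ℕ→ℚ m * (+ n / d) ≡ + l / e
ℕ→ℚ-*-/ m n l (suc d) (suc e) eq = ℚₚ.toℚᵘ-injective (begin
  toℚᵘ (ℕ→ℚ m * (+ n / suc d))              ≈⟨ ℚₚ.toℚᵘ-homo-* (ℕ→ℚ m) (+ n / suc d) ⟩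
  toℚᵘ (ℕ→ℚ m) ℚᵘ.* toℚᵘ (+ n / suc d)      ≈⟨ ℚᵘₚ.*-cong (toℚᵘ-/ (+ m) 0) (toℚᵘ-/ (+ n) d) ⟩
  mkℚᵘ (+ m) 0 ℚᵘ.* mkℚᵘ (+ n) d            ≈⟨ *≡* cross ⟩
  mkℚᵘ (+ l) e                              ≈⟨ toℚᵘ-/ (+ l) e ⟨
  toℚᵘ (+ l / suc e)                        ∎)
  where
  open ℚᵘₚ.≃-Reasoning
  -- The denominator `1 * suc d` of the product reduces to `suc (d + 0)`, hence the added zero.
  cross : + m ℤ.* + n ℤ.* + suc e ≡ + l ℤ.* + suc (d ℕ.+ 0)
  cross = trans (cong (ℤ._* + suc e) (sym (ℤₚ.pos-* m n)))
         (trans (sym (ℤₚ.pos-* (m ℕ.* n) (suc e)))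
         (trans (cong +_ (trans eq (cong (λ d → l ℕ.* suc d) (sym (ℕₚ.+-identityʳ d)))))
                (ℤₚ.pos-* l _)))

0≤ℕ→ℚ : ∀ n → 0ℚ ≤ ℕ→ℚ n
0≤ℕ→ℚ n = ℚₚ.nonNegative⁻¹ (ℕ→ℚ n) {{ℚₚ.normalize-nonNeg n 1}}

ℕ→ℚ-mono-≤ : ∀ {m n} → m ℕ.≤ n → ℕ→ℚ m ≤ ℕ→ℚ n
ℕ→ℚ-mono-≤ {m} {n} m≤n = begin
  ℕ→ℚ m                   ≡⟨ ℚₚ.+-identityʳ (ℕ→ℚ m) ⟨
  ℕ→ℚ m + 0ℚ              ≤⟨ ℚₚ.+-monoʳ-≤ (ℕ→ℚ m) (0≤ℕ→ℚ (n ℕ.∸ m)) ⟩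
  ℕ→ℚ m + ℕ→ℚ (n ℕ.∸ m)   ≡⟨ ℕ→ℚ-+ m (n ℕ.∸ m) ⟨
  ℕ→ℚ (m ℕ.+ (n ℕ.∸ m))   ≡⟨ cong ℕ→ℚ (ℕₚ.m+[n∸m]≡n m≤n) ⟩
  ℕ→ℚ n                   ∎
  where open ℚₚ.≤-Reasoning

ℕ→ℚ-*-cancelˡ-≤ : ∀ n .{{_ : ℕ.NonZero n}} {x y} → ℕ→ℚ n * x ≤ ℕ→ℚ n * y → x ≤ y
ℕ→ℚ-*-cancelˡ-≤ n = ℚₚ.*-cancelˡ-≤-pos (ℕ→ℚ n) {{ℚₚ.normalize-pos n 1}}

-- Serves to show `s ≥ 1` with `x = (|G| - 2c)/p` and `n = c`: a positive `c` gives the bound at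
-- once, so a lower bound on `x` is asked for only when `c = 0`.
1≤x+n : ∀ n {x} → 0ℚ ≤ x → (n ≡ 0 → 1ℚ ≤ x) → 1ℚ ≤ x + ℕ→ℚ n
1≤x+n zero    {x} 0≤x 1≤x = ℚₚ.≤-trans (1≤x refl) (ℚₚ.≤-reflexive (sym (ℚₚ.+-identityʳ x)))
1≤x+n (suc n) {x} 0≤x 1≤x = ℚₚ.+-mono-≤ 0≤x (ℕ→ℚ-mono-≤ {1} {suc n} (ℕ.s≤s ℕ.z≤n))

*-monoʳ : ∀ {x y z} → 0ℚ ≤ z → x ≤ y → x * z ≤ y * z
*-monoʳ {z = z} 0≤z = ℚₚ.*-monoʳ-≤-nonNeg z {{nonNegative 0≤z}}

*-monoˡ : ∀ {x y z} → 0ℚ ≤ z → x ≤ y → z * x ≤ z * y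
*-monoˡ {z = z} 0≤z = ℚₚ.*-monoˡ-≤-nonNeg z {{nonNegative 0≤z}}

0≤* : ∀ {x y} → 0ℚ ≤ x → 0ℚ ≤ y → 0ℚ ≤ x * y
0≤* {x} 0≤x 0≤y = ℚₚ.≤-trans (ℚₚ.≤-reflexive (sym (ℚₚ.*-zeroʳ x))) (*-monoˡ 0≤x 0≤y)

0≤+ : ∀ {x y} → 0ℚ ≤ x → 0ℚ ≤ y → 0ℚ ≤ x + y
0≤+ = ℚₚ.+-mono-≤

-- Generalised binomial coefficients and Pascal's rule

invFact : ℕ → ℚ
invFact k = (+ 1 / k !) {{ k ℕₚ.!≢0 }}

invFact-suc : ∀ k → ℕ→ℚ (suc k) * invFact (suc k) ≡ invFact k
invFact-suc k = ℕ→ℚ-*-/ (suc k) 1 1 (suc k !) (k !) {{ suc k ℕₚ.!≢0 }} {{ k ℕₚ.!≢0 }}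
  (trans (cong (ℕ._* k !) (ℕₚ.*-identityʳ (suc k))) (sym (ℕₚ.*-identityˡ (suc k !))))

-- The definition splits off the last factor; here the first factor is split off instead, as needed
-- when the upper argument grows by one along with `k`.
fallingFactorial-1+ : ∀ x k → fallingFactorial (1ℚ + x) (suc k) ≡ (1ℚ + x) * fallingFactorial x k
fallingFactorial-1+ x zero = ring x
  where
  ring : ∀ x → 1ℚ * ((1ℚ + x) - 0ℚ) ≡ (1ℚ + x) * 1ℚ
  ring = solve-∀ ℚ-ring
fallingFactorial-1+ x (suc k) = begin
  fallingFactorial (1ℚ + x) (suc k) * ((1ℚ + x) - ℕ→ℚ (suc k))
    ≡⟨ cong₂ (λ f n → f * ((1ℚ + x) - n)) (fallingFactorial-1+ x k) (ℕ→ℚ-suc k) ⟩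
  (1ℚ + x) * fallingFactorial x k * ((1ℚ + x) - (1ℚ + ℕ→ℚ k))
    ≡⟨ ring x (fallingFactorial x k) (ℕ→ℚ k) ⟩
  (1ℚ + x) * (fallingFactorial x k * (x - ℕ→ℚ k))
    ∎
  where
  open ≡-Reasoning
  ring : ∀ x f n → (1ℚ + x) * f * ((1ℚ + x) - (1ℚ + n)) ≡ (1ℚ + x) * (f * (x - n))
  ring = solve-∀ ℚ-ring

-- Split the leading factor `1 + x` as `(x - k) + (1 + k)`: the first part extends the falling
-- factorial, the second cancels against `1/(k+1)!`.
binomial-pascal : ∀ x k → binomial (1ℚ + x) (suc k) ≡ binomial x (suc k) + binomial x k
binomial-pascal x k = begin
  fallingFactorial (1ℚ + x) (suc k) * i
    ≡⟨ cong (_* i) (fallingFactorial-1+ x k) ⟩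
  (1ℚ + x) * f * i
    ≡⟨ ring x f (ℕ→ℚ k) i ⟩
  f * (x - ℕ→ℚ k) * i + f * ((1ℚ + ℕ→ℚ k) * i)
    ≡⟨ cong (λ n → f * (x - ℕ→ℚ k) * i + f * (n * i)) (ℕ→ℚ-suc k) ⟨
  f * (x - ℕ→ℚ k) * i + f * (ℕ→ℚ (suc k) * i)
    ≡⟨ cong (λ j → f * (x - ℕ→ℚ k) * i + f * j) (invFact-suc k) ⟩
  f * (x - ℕ→ℚ k) * i + f * invFact k
    ∎
  where
  open ≡-Reasoning
  f i : ℚ
  f = fallingFactorial x k
  i = invFact (suc k)
  ring : ∀ x f n i → (1ℚ + x) * f * i ≡ f * (x - n) * i + f * ((1ℚ + n) * i)
  ring = solve-∀ ℚ-ring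

binomial-0-suc : ∀ k → binomial 0ℚ (suc k) ≡ 0ℚ
binomial-0-suc k = trans (cong (_* invFact (suc k)) (vanishes k)) (ℚₚ.*-zeroˡ (invFact (suc k)))
  where
  vanishes : ∀ k → fallingFactorial 0ℚ (suc k) ≡ 0ℚ
  vanishes zero    = refl
  vanishes (suc k) = trans (cong (_* (0ℚ - ℕ→ℚ (suc k))) (vanishes k)) (ℚₚ.*-zeroˡ (0ℚ - ℕ→ℚ (suc k)))

-- Multiset coefficients, the coefficients of `(1 - z)^(-s)`

multichoose : ℚ → ℕ → ℚ
multichoose s k = binomial (s + ℕ→ℚ k - 1ℚ) k

partialSum : (ℕ → ℚ) → ℕ → ℚ
partialSum f zero    = 0ℚ
partialSum f (suc k) = partialSum f k + f k

multichoose-suc : ∀ s k → ℕ→ℚ (suc k) * multichoose s (suc k) ≡ (s + ℕ→ℚ k) * multichoose s k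
multichoose-suc s k = begin
  ℕ→ℚ (suc k) * (fallingFactorial (s + ℕ→ℚ (suc k) - 1ℚ) (suc k) * i)
    ≡⟨ cong (λ y → ℕ→ℚ (suc k) * (fallingFactorial y (suc k) * i))
         (trans (cong (λ n → s + n - 1ℚ) (ℕ→ℚ-suc k)) (ring₁ s (ℕ→ℚ k))) ⟩
  ℕ→ℚ (suc k) * (fallingFactorial (1ℚ + x) (suc k) * i)
    ≡⟨ cong (λ f → ℕ→ℚ (suc k) * (f * i)) (fallingFactorial-1+ x k) ⟩
  ℕ→ℚ (suc k) * ((1ℚ + x) * f * i)
    ≡⟨ ring₂ (ℕ→ℚ (suc k)) s (ℕ→ℚ k) f i ⟩
  (s + ℕ→ℚ k) * (f * (ℕ→ℚ (suc k) * i))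
    ≡⟨ cong (λ j → (s + ℕ→ℚ k) * (f * j)) (invFact-suc k) ⟩
  (s + ℕ→ℚ k) * (f * invFact k)
    ∎
  where
  open ≡-Reasoning
  x f i : ℚ
  x = s + ℕ→ℚ k - 1ℚ
  f = fallingFactorial x k
  i = invFact (suc k)
  ring₁ : ∀ s n → s + (1ℚ + n) - 1ℚ ≡ 1ℚ + (s + n - 1ℚ)
  ring₁ = solve-∀ ℚ-ring
  ring₂ : ∀ m s n f i → m * ((1ℚ + (s + n - 1ℚ)) * f * i) ≡ (s + n) * (f * (m * i))
  ring₂ = solve-∀ ℚ-ring

-- Coefficient form of `z d/dz (1 - z)^(-s) = s z/(1 - z) * (1 - z)^(-s)`. It is the recursion that
-- Newton's identities would give with every weight equal to `s`.
multichoose-partialSum : ∀ s k → ℕ→ℚ k * multichoose s k ≡ s * partialSum (multichoose s) k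
multichoose-partialSum s zero    = trans (ℚₚ.*-zeroˡ (multichoose s 0)) (sym (ℚₚ.*-zeroʳ s))
multichoose-partialSum s (suc k) = begin
  ℕ→ℚ (suc k) * multichoose s (suc k)                ≡⟨ multichoose-suc s k ⟩
  (s + ℕ→ℚ k) * B                                    ≡⟨ ℚₚ.*-distribʳ-+ B s (ℕ→ℚ k) ⟩
  s * B + ℕ→ℚ k * B                                  ≡⟨ cong (λ y → s * B + y) (multichoose-partialSum s k) ⟩
  s * B + s * partialSum (multichoose s) k           ≡⟨ ring s B (partialSum (multichoose s) k) ⟩
  s * (partialSum (multichoose s) k + B)             ∎
  where
  open ≡-Reasoning
  B : ℚ
  B = multichoose s k
  ring : ∀ s b r → s * b + s * r ≡ s * (r + b)
  ring = solve-∀ ℚ-ring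

0≤multichoose : ∀ {s} → 0ℚ ≤ s → ∀ k → 0ℚ ≤ multichoose s k
0≤multichoose         0≤s zero    = ℚₚ.nonNegative⁻¹ 1ℚ
0≤multichoose {s = s} 0≤s (suc k) = ℕ→ℚ-*-cancelˡ-≤ (suc k) (begin
  ℕ→ℚ (suc k) * 0ℚ                      ≡⟨ ℚₚ.*-zeroʳ (ℕ→ℚ (suc k)) ⟩
  0ℚ                                    ≤⟨ 0≤* (0≤+ 0≤s (0≤ℕ→ℚ k)) (0≤multichoose 0≤s k) ⟩
  (s + ℕ→ℚ k) * multichoose s k         ≡⟨ multichoose-suc s k ⟨
  ℕ→ℚ (suc k) * multichoose s (suc k)   ∎)
  where open ℚₚ.≤-Reasoning

-- Consecutive values have ratio `(s + k)/(1 + k)`, which is at least one exactly because `s ≥ 1`.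
multichoose-mono : ∀ {s} → 1ℚ ≤ s → ∀ k → multichoose s k ≤ multichoose s (suc k)
multichoose-mono {s} 1≤s k = ℕ→ℚ-*-cancelˡ-≤ (suc k) (begin
  ℕ→ℚ (suc k) * multichoose s k         ≡⟨ cong (_* multichoose s k) (ℕ→ℚ-suc k) ⟩
  (1ℚ + ℕ→ℚ k) * multichoose s k        ≤⟨ *-monoʳ (0≤multichoose 0≤s k) (ℚₚ.+-monoˡ-≤ (ℕ→ℚ k) 1≤s) ⟩
  (s + ℕ→ℚ k) * multichoose s k         ≡⟨ multichoose-suc s k ⟨
  ℕ→ℚ (suc k) * multichoose s (suc k)   ∎)
  where
  open ℚₚ.≤-Reasoning
  0≤s : 0ℚ ≤ s
  0≤s = ℚₚ.≤-trans (ℚₚ.nonNegative⁻¹ 1ℚ) 1≤s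

-- Sums over a subset of the indices

module ℚ-Sum = CommutativeMonoidSum ℚₚ.+-0-commutativeMonoid

interchange-+ : ∀ w x y z → (w + x) + (y + z) ≡ (w + y) + (x + z)
interchange-+ = solve-∀ ℚ-ring

interchange-- : ∀ w x y z → (w - x) + (y - z) ≡ (w + y) - (x + z)
interchange-- = solve-∀ ℚ-ring

sumOver : ∀ {n} → Subset n → (Fin n → ℚ) → ℚ
sumOver []            g = 0ℚ
sumOver (outside ∷ D) g = sumOver D (g ∘ suc)
sumOver (inside  ∷ D) g = g zero + sumOver D (g ∘ suc)

sumOver-cong : ∀ {n} (D : Subset n) {g h} → (∀ i → g i ≡ h i) → sumOver D g ≡ sumOver D h
sumOver-cong []            g≗h = refl
sumOver-cong (outside ∷ D) g≗h = sumOver-cong D (g≗h ∘ suc)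
sumOver-cong (inside  ∷ D) g≗h = cong₂ _+_ (g≗h zero) (sumOver-cong D (g≗h ∘ suc))

sumOver-zero : ∀ {n} (D : Subset n) → sumOver D (λ _ → 0ℚ) ≡ 0ℚ
sumOver-zero []            = refl
sumOver-zero (outside ∷ D) = sumOver-zero D
sumOver-zero (inside  ∷ D) = trans (ℚₚ.+-identityˡ (sumOver D (λ _ → 0ℚ))) (sumOver-zero D)

sumOver-+ : ∀ {n} (D : Subset n) g h → sumOver D (λ i → g i + h i) ≡ sumOver D g + sumOver D h
sumOver-+ []            g h = refl
sumOver-+ (outside ∷ D) g h = sumOver-+ D (g ∘ suc) (h ∘ suc)
sumOver-+ (inside  ∷ D) g h = trans (cong (λ s → g zero + h zero + s) (sumOver-+ D (g ∘ suc) (h ∘ suc)))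
  (interchange-+ (g zero) (h zero) (sumOver D (g ∘ suc)) (sumOver D (h ∘ suc)))

sumOver-- : ∀ {n} (D : Subset n) g h → sumOver D (λ i → g i - h i) ≡ sumOver D g - sumOver D h
sumOver-- []            g h = refl
sumOver-- (outside ∷ D) g h = sumOver-- D (g ∘ suc) (h ∘ suc)
sumOver-- (inside  ∷ D) g h = trans (cong (λ s → g zero - h zero + s) (sumOver-- D (g ∘ suc) (h ∘ suc)))
  (interchange-- (g zero) (h zero) (sumOver D (g ∘ suc)) (sumOver D (h ∘ suc)))

sumOver-∁ : ∀ {n} (D : Subset n) g → sumOver D g + sumOver (∁ D) g ≡ ℚ-Sum.sum g
sumOver-∁ []            g = refl
sumOver-∁ (outside ∷ D) g = trans (ring (sumOver D (g ∘ suc)) (g zero) (sumOver (∁ D) (g ∘ suc)))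
  (cong (λ s → g zero + s) (sumOver-∁ D (g ∘ suc)))
  where
  ring : ∀ x y z → x + (y + z) ≡ y + (x + z)
  ring = solve-∀ ℚ-ring
sumOver-∁ (inside  ∷ D) g = trans (ℚₚ.+-assoc (g zero) (sumOver D (g ∘ suc)) (sumOver (∁ D) (g ∘ suc)))
  (cong (λ s → g zero + s) (sumOver-∁ D (g ∘ suc)))

∣sumOver∣≤ : ∀ {n} (D : Subset n) g {B} → (∀ i → ∥ g i ∥ ≤ B) → ∥ sumOver D g ∥ ≤ ℕ→ℚ ∣ D ∣ * B
∣sumOver∣≤ []            g {B} g≤B = ℚₚ.≤-reflexive (sym (ℚₚ.*-zeroˡ B))
∣sumOver∣≤ (outside ∷ D) g     g≤B = ∣sumOver∣≤ D (g ∘ suc) (g≤B ∘ suc)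
∣sumOver∣≤ (inside  ∷ D) g {B} g≤B = begin
  ∥ g zero + sumOver D (g ∘ suc) ∥          ≤⟨ ℚₚ.∣p+q∣≤∣p∣+∣q∣ (g zero) (sumOver D (g ∘ suc)) ⟩
  ∥ g zero ∥ + ∥ sumOver D (g ∘ suc) ∥      ≤⟨ ℚₚ.+-mono-≤ (g≤B zero) (∣sumOver∣≤ D (g ∘ suc) (g≤B ∘ suc)) ⟩
  B + ℕ→ℚ ∣ D ∣ * B                         ≡⟨ ring B (ℕ→ℚ ∣ D ∣) ⟩
  (1ℚ + ℕ→ℚ ∣ D ∣) * B                      ≡⟨ cong (_* B) (ℕ→ℚ-suc ∣ D ∣) ⟨
  ℕ→ℚ (suc ∣ D ∣) * B                       ∎
  where
  open ℚₚ.≤-Reasoning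
  ring : ∀ b n → b + n * b ≡ (1ℚ + n) * b
  ring = solve-∀ ℚ-ring

-- Power series with coefficients in functions on the group, and Newton's identities

module Families {a ℓ} (𝔾 : AbelianGroup a ℓ) where
  open AbelianGroup 𝔾 renaming (_-_ to _//_; refl to ≈-refl; sym to ≈-sym; trans to ≈-trans)

  -- A family f stands for the power series ∑ₖ f k zᵏ whose coefficients are
  -- functions on the group.  Translation by x is written as multiplication by
  -- x: shift x is multiplication by z x, alternate x by z x / (1 + z x), and
  -- expand φ D e is φ times the product of the 1 + z (e i) over i in D.
  Family : Set a
  Family = ℕ → Carrier → ℚ

  Congruent : Family → Set (a ⊔ ℓ)
  Congruent f = ∀ k {b b′} → b ≈ b′ → f k b ≡ f k b′

  infixl 6 _⊞_
  _⊞_ : Family → Family → Family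
  (f ⊞ g) k b = f k b + g k b

  shift : Carrier → Family → Family
  shift x f zero    b = 0ℚ
  shift x f (suc k) b = f k (b // x)

  alternate : Carrier → Family → Family
  alternate x f zero    b = 0ℚ
  alternate x f (suc k) b = f k (b // x) - alternate x f k (b // x)

  expand : (Carrier → ℚ) → ∀ {n} → Subset n → (Fin n → Carrier) → Family
  expand φ []            e zero    b = φ b
  expand φ []            e (suc k) b = 0ℚ
  expand φ (outside ∷ D) e = expand φ D (e ∘ suc)
  expand φ (inside  ∷ D) e = expand φ D (e ∘ suc) ⊞ shift (e zero) (expand φ D (e ∘ suc))

  expand-zero : ∀ φ {n} (D : Subset n) e b → expand φ D e 0 b ≡ φ b
  expand-zero φ []            e b = refl
  expand-zero φ (outside ∷ D) e b = expand-zero φ D (e ∘ suc) b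
  expand-zero φ (inside  ∷ D) e b = trans (ℚₚ.+-identityʳ _) (expand-zero φ D (e ∘ suc) b)

  //-swap : ∀ b x y → (b // x) // y ≈ (b // y) // x
  //-swap b x y = ≈-trans (assoc b (x ⁻¹) (y ⁻¹))
    (≈-trans (∙-congˡ (comm (x ⁻¹) (y ⁻¹))) (≈-sym (assoc b (y ⁻¹) (x ⁻¹))))

  shift-cong : ∀ x {f} → Congruent f → Congruent (shift x f)
  shift-cong x f-cong zero    b≈b′ = refl
  shift-cong x f-cong (suc k) b≈b′ = f-cong k (∙-congʳ b≈b′)

  alternate-cong : ∀ x {f} → Congruent f → Congruent (alternate x f)
  alternate-cong x f-cong zero    b≈b′ = refl
  alternate-cong x f-cong (suc k) b≈b′ =
    cong₂ _-_ (f-cong k (∙-congʳ b≈b′)) (alternate-cong x f-cong k (∙-congʳ b≈b′))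

  expand-cong : ∀ {φ} → (∀ {b b′} → b ≈ b′ → φ b ≡ φ b′) →
                ∀ {n} (D : Subset n) e → Congruent (expand φ D e)
  expand-cong φ-cong []            e zero    b≈b′ = φ-cong b≈b′
  expand-cong φ-cong []            e (suc k) b≈b′ = refl
  expand-cong φ-cong (outside ∷ D) e k       b≈b′ = expand-cong φ-cong D (e ∘ suc) k b≈b′
  expand-cong φ-cong (inside  ∷ D) e k       b≈b′ = cong₂ _+_
    (expand-cong φ-cong D (e ∘ suc) k b≈b′)
    (shift-cong (e zero) (expand-cong φ-cong D (e ∘ suc)) k b≈b′)

  alternate-⊞ : ∀ x f g k b → alternate x (f ⊞ g) k b ≡ alternate x f k b + alternate x g k b
  alternate-⊞ x f g zero    b = refl
  alternate-⊞ x f g (suc k) b = trans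
    (cong (λ y → f k (b // x) + g k (b // x) - y) (alternate-⊞ x f g k (b // x)))
    (sym (interchange-- (f k (b // x)) (alternate x f k (b // x)) (g k (b // x)) (alternate x g k (b // x))))

  -- Multiplications by two series commute. Congruence of `f` is required because `b - x - y` and
  -- `b - y - x` agree only up to `≈`.
  alternate-shift : ∀ x y {f} → Congruent f → ∀ k b →
                    alternate y (shift x f) k b ≡ shift x (alternate y f) k b
  alternate-shift x y {f} f-cong zero          b = refl
  alternate-shift x y {f} f-cong (suc zero)    b = refl
  alternate-shift x y {f} f-cong (suc (suc k)) b = cong₂ _-_
    (f-cong k (//-swap b y x))
    (trans (alternate-shift x y f-cong (suc k) (b // y)) (alternate-cong y f-cong k (//-swap b y x)))

  -- The factor `1 + z x` cancels the denominator of `z x / (1 + z x)`; on coefficients the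
  -- alternating sum telescopes.
  alternate-⊞-shift : ∀ x f k b → alternate x (f ⊞ shift x f) k b ≡ shift x f k b
  alternate-⊞-shift x f zero    b = refl
  alternate-⊞-shift x f (suc k) b = trans
    (cong (λ y → f k (b // x) + shift x f k (b // x) - y) (alternate-⊞-shift x f k (b // x)))
    (ring (f k (b // x)) (shift x f k (b // x)))
    where
    ring : ∀ u v → u + v - v ≡ u
    ring = solve-∀ ℚ-ring

  -- Apply z d/dz to the product defining expand: z d/dz (1 + z x) = z x.
  newton : ∀ {φ} → (∀ {b b′} → b ≈ b′ → φ b ≡ φ b′) → ∀ {n} (D : Subset n) e k b →
           ℕ→ℚ k * expand φ D e k b ≡ sumOver D (λ i → alternate (e i) (expand φ D e) k b)
  newton {φ} φ-cong [] e zero    b = ℚₚ.*-zeroˡ (φ b)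
  newton     φ-cong [] e (suc k) b = ℚₚ.*-zeroʳ (ℕ→ℚ (suc k))
  newton     φ-cong (outside ∷ D) e k b = newton φ-cong D (e ∘ suc) k b
  newton {φ} φ-cong (inside  ∷ D) e k b = begin
    ℕ→ℚ k * (f k b + shift x f k b)
      ≡⟨ ℚₚ.*-distribˡ-+ (ℕ→ℚ k) (f k b) (shift x f k b) ⟩
    ℕ→ℚ k * f k b + ℕ→ℚ k * shift x f k b
      ≡⟨ cong₂ _+_ (newton φ-cong D (e ∘ suc) k b) (weighted-shift k b) ⟩
    A k b + (shift x f k b + shift x A k b)
      ≡⟨ ring (A k b) (shift x f k b) (shift x A k b) ⟩
    shift x f k b + (A k b + shift x A k b)
      ≡⟨ cong₂ _+_ (alternate-⊞-shift x f k b) distribute ⟨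
    alternate x (f ⊞ shift x f) k b + sumOver D (λ i → alternate (e (suc i)) (f ⊞ shift x f) k b)
      ∎
    where
    open ≡-Reasoning
    x : Carrier
    x = e zero
    f A : Family
    f = expand φ D (e ∘ suc)
    A k b = sumOver D (λ i → alternate (e (suc i)) f k b)
    f-cong : Congruent f
    f-cong = expand-cong φ-cong D (e ∘ suc)
    ring : ∀ u v w → u + (v + w) ≡ v + (u + w)
    ring = solve-∀ ℚ-ring
    ring₂ : ∀ n u → (1ℚ + n) * u ≡ u + n * u
    ring₂ = solve-∀ ℚ-ring
    -- Product rule for `z d/dz` on `z x f`: the weight splits into one for the new factor `z` and
    -- `k - 1` for `f`, and the latter is handled by induction.
    weighted-shift : ∀ k b → ℕ→ℚ k * shift x f k b ≡ shift x f k b + shift x A k b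
    weighted-shift zero    b = refl
    weighted-shift (suc k) b = trans (cong (_* f k (b // x)) (ℕ→ℚ-suc k))
      (trans (ring₂ (ℕ→ℚ k) (f k (b // x)))
        (cong (λ y → f k (b // x) + y) (newton φ-cong D (e ∘ suc) k (b // x))))
    sumOver-shift : ∀ k b → sumOver D (λ i → shift x (alternate (e (suc i)) f) k b) ≡ shift x A k b
    sumOver-shift zero    b = sumOver-zero D
    sumOver-shift (suc k) b = refl
    distribute : sumOver D (λ i → alternate (e (suc i)) (f ⊞ shift x f) k b) ≡ A k b + shift x A k b
    distribute = begin
      sumOver D (λ i → alternate (e (suc i)) (f ⊞ shift x f) k b)
        ≡⟨ sumOver-cong D (λ i → trans (alternate-⊞ (e (suc i)) f (shift x f) k b)
             (cong (λ y → alternate (e (suc i)) f k b + y) (alternate-shift x (e (suc i)) f-cong k b))) ⟩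
      sumOver D (λ i → alternate (e (suc i)) f k b + shift x (alternate (e (suc i)) f) k b)
        ≡⟨ sumOver-+ D _ _ ⟩
      A k b + sumOver D (λ i → shift x (alternate (e (suc i)) f) k b)
        ≡⟨ cong (λ y → A k b + y) (sumOver-shift k b) ⟩
      A k b + shift x A k b
        ∎

-- Counting subsets by their first entry

length-filter-map : ∀ {a b p} {A : Set a} {B : Set b} {P : Pred.Pred B p} (P? : Pred.Decidable P) (f : A → B) xs →
                    length (filter P? (map f xs)) ≡ length (filter (λ x → P? (f x)) xs)
length-filter-map P? f []       = refl
length-filter-map P? f (x ∷ xs) with does (P? (f x))
... | true  = cong suc (length-filter-map P? f xs)
... | false = length-filter-map P? f xs

-- Equivalence `≐` is enough on each half, so each half can be recounted with the decision procedure
-- for the shorter problem.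
length-filter-subsets : ∀ {n p q r} {P : Pred.Pred (Subset (suc n)) p} {Q : Pred.Pred (Subset n) q} {R : Pred.Pred (Subset n) r}
  (P? : Pred.Decidable P) (Q? : Pred.Decidable Q) (R? : Pred.Decidable R) →
  (λ S → P (outside ∷ S)) Pred.≐ Q → (λ S → P (inside ∷ S)) Pred.≐ R →
  length (filter P? (subsets (suc n))) ≡ length (filter Q? (subsets n)) ℕ.+ length (filter R? (subsets n))
length-filter-subsets {n} P? Q? R? outside≐ inside≐ = trans
  (trans (cong length (filter-++ P? (map (outside ∷_) (subsets n)) (map (inside ∷_) (subsets n))))
         (length-++ (filter P? (map (outside ∷_) (subsets n)))))
  (cong₂ ℕ._+_
    (trans (length-filter-map P? (outside ∷_) (subsets n)) (cong length (filter-≐ _ Q? outside≐ (subsets n))))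
    (trans (length-filter-map P? (inside ∷_) (subsets n)) (cong length (filter-≐ _ R? inside≐ (subsets n)))))

length-filter-subsets-outside : ∀ {n p q} {P : Pred.Pred (Subset (suc n)) p} {Q : Pred.Pred (Subset n) q}
  (P? : Pred.Decidable P) (Q? : Pred.Decidable Q) →
  (λ S → P (outside ∷ S)) Pred.≐ Q → (∀ S → ¬ P (inside ∷ S)) →
  length (filter P? (subsets (suc n))) ≡ length (filter Q? (subsets n))
length-filter-subsets-outside {n} {P = P} P? Q? outside≐ ¬inside = trans
  (length-filter-subsets P? Q? inside? outside≐ (id , id))
  (trans (cong (λ xs → length (filter Q? (subsets n)) ℕ.+ length xs) (filter-none inside? (All.universal ¬inside (subsets n))))
    (ℕₚ.+-identityʳ _))
  where
  inside? : Pred.Decidable (λ S → P (inside ∷ S))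
  inside? S = P? (inside ∷ S)

-- Subset-sum counts as coefficients of the product

∣1-x∣≤1 : ∀ {x} → 0ℚ ≤ x → x ≤ 1ℚ → ∥ 1ℚ - x ∥ ≤ 1ℚ
∣1-x∣≤1 {x} 0≤x x≤1 = begin
  ∥ 1ℚ - x ∥   ≡⟨ ℚₚ.0≤p⇒∣p∣≡p 0≤1-x ⟩
  1ℚ - x       ≤⟨ ℚₚ.+-monoʳ-≤ 1ℚ (ℚₚ.neg-antimono-≤ 0≤x) ⟩
  1ℚ           ∎
  where
  open ℚₚ.≤-Reasoning
  0≤1-x : 0ℚ ≤ 1ℚ - x
  0≤1-x = ℚₚ.≤-trans (ℚₚ.≤-reflexive (sym (ℚₚ.+-inverseʳ x))) (ℚₚ.+-monoˡ-≤ (- x) x≤1)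

∣0-x∣≤1 : ∀ {x} → 0ℚ ≤ x → x ≤ 1ℚ → ∥ 0ℚ - x ∥ ≤ 1ℚ
∣0-x∣≤1 {x} 0≤x x≤1 = begin
  ∥ 0ℚ - x ∥   ≡⟨ cong ∥_∥ (ℚₚ.+-identityˡ (- x)) ⟩
  ∥ - x ∥      ≡⟨ ℚₚ.∣-p∣≡∣p∣ x ⟩
  ∥ x ∥        ≡⟨ ℚₚ.0≤p⇒∣p∣≡p 0≤x ⟩
  x            ≤⟨ x≤1 ⟩
  1ℚ           ∎
  where open ℚₚ.≤-Reasoning

module Counting {a ℓ} (𝔾 : AbelianGroup a ℓ) (_≈?_ : Decidable (AbelianGroup._≈_ 𝔾)) where
  open AbelianGroup 𝔾 renaming (_-_ to _//_; refl to ≈-refl; sym to ≈-sym; trans to ≈-trans)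
  open RawMonoidDefs rawMonoid using (sum)
  open Families 𝔾
  open import Algebra.Properties.Group group using (//-rightDividesˡ; //-rightDividesʳ)

  -- The counting notions are restated for an arbitrary finite tuple `e` of group elements, so that
  -- induction can drop its first entry.
  subsetSumOf : ∀ {n} → (Fin n → Carrier) → Subset n → Carrier
  subsetSumOf e S = sum λ i → if lookup S i then e i else ε

  Solves : ∀ {n} → Subset n → (Fin n → Carrier) → ℕ → Carrier → Subset n → Set ℓ
  Solves D e k b S = S ⊆ D × ∣ S ∣ ≡ k × subsetSumOf e S ≈ b

  solves? : ∀ {n} (D : Subset n) e k b → Pred.Decidable (Solves D e k b)
  solves? D e k b S = (S ⊆? D) ×-dec (∣ S ∣ ℕₚ.≟ k) ×-dec (subsetSumOf e S ≈? b)

  count : ∀ {n} → Subset n → (Fin n → Carrier) → ℕ → Carrier → ℕ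
  count {n} D e k b = length (filter (solves? D e k b) (subsets n))

  outside-solves : ∀ {n} s (D : Subset n) e k b →
                   (λ S → Solves (s ∷ D) e k b (outside ∷ S)) Pred.≐ Solves D (e ∘ suc) k b
  outside-solves s D e k b =
    (λ (S⊆D , ∣S∣≡k , ∑≈b) → drop-∷-⊆ S⊆D , ∣S∣≡k , ≈-trans (≈-sym (identityˡ _)) ∑≈b) ,
    (λ (S⊆D , ∣S∣≡k , ∑≈b) → out⊆ S⊆D , ∣S∣≡k , ≈-trans (identityˡ _) ∑≈b)

  inside-solves : ∀ {n} (D : Subset n) e k b →
                  (λ S → Solves (inside ∷ D) e (suc k) b (inside ∷ S)) Pred.≐ Solves D (e ∘ suc) k (b // e zero)
  inside-solves D e k b =
    (λ (S⊆D , ∣S∣≡k , ∑≈b) → drop-∷-⊆ S⊆D , ℕₚ.suc-injective ∣S∣≡k ,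
      ≈-trans (≈-sym (//-rightDividesʳ (e zero) _)) (∙-congʳ (≈-trans (comm _ (e zero)) ∑≈b))) ,
    (λ (S⊆D , ∣S∣≡k , ∑≈b) → s⊆s S⊆D , cong suc ∣S∣≡k ,
      ≈-trans (comm (e zero) _) (≈-trans (∙-congʳ ∑≈b) (//-rightDividesˡ (e zero) b)))

  count-outside : ∀ {n} (D : Subset n) e k b → count (outside ∷ D) e k b ≡ count D (e ∘ suc) k b
  count-outside D e k b = length-filter-subsets-outside (solves? (outside ∷ D) e k b) (solves? D (e ∘ suc) k b)
    (outside-solves outside D e k b) (λ S (S⊆D , _) → zero∉ (S⊆D here))
    where
    zero∉ : zero ∉ outside ∷ D
    zero∉ ()

  count-inside-zero : ∀ {n} (D : Subset n) e b → count (inside ∷ D) e 0 b ≡ count D (e ∘ suc) 0 b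
  count-inside-zero D e b = length-filter-subsets-outside (solves? (inside ∷ D) e 0 b) (solves? D (e ∘ suc) 0 b)
    (outside-solves inside D e 0 b) (λ S (_ , ∣S∣≡0 , _) → ℕₚ.1+n≢0 ∣S∣≡0)

  count-inside-suc : ∀ {n} (D : Subset n) e k b →
    count (inside ∷ D) e (suc k) b ≡ count D (e ∘ suc) (suc k) b ℕ.+ count D (e ∘ suc) k (b // e zero)
  count-inside-suc D e k b = length-filter-subsets (solves? (inside ∷ D) e (suc k) b)
    (solves? D (e ∘ suc) (suc k) b) (solves? D (e ∘ suc) k (b // e zero)) 
    (outside-solves inside D e (suc k) b) (inside-solves D e k b)

  -- The test is oriented as `ε ≈? b` because the empty subset has sum `ε`; this makes it the same
  -- test that decides the count over the empty tuple.
  indicator : Carrier → ℚ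
  indicator b = if does (ε ≈? b) then 1ℚ else 0ℚ

  indicator-cong : ∀ {x y} → x ≈ y → indicator x ≡ indicator y
  indicator-cong {x} {y} x≈y with ε ≈? x | ε ≈? y
  ... | yes _   | yes _   = refl
  ... | no  _   | no  _   = refl
  ... | yes ε≈x | no  ε≉y = contradiction (≈-trans ε≈x x≈y) ε≉y
  ... | no  ε≉x | yes ε≈y = contradiction (≈-trans ε≈y (≈-sym x≈y)) ε≉x

  indicator-yes : ∀ {x} → ε ≈ x → indicator x ≡ 1ℚ
  indicator-yes {x} ε≈x with ε ≈? x
  ... | yes _   = refl
  ... | no  ε≉x = contradiction ε≈x ε≉x

  indicator-no : ∀ {x} → ¬ (ε ≈ x) → indicator x ≡ 0ℚ
  indicator-no {x} ε≉x with ε ≈? x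
  ... | yes ε≈x = contradiction ε≈x ε≉x
  ... | no  _   = refl

  ∣indicator-x∣≤1 : ∀ {x} → 0ℚ ≤ x → x ≤ 1ℚ → ∀ b → ∥ indicator b - x ∥ ≤ 1ℚ
  ∣indicator-x∣≤1 0≤x x≤1 b with ε ≈? b
  ... | yes _ = ∣1-x∣≤1 0≤x x≤1
  ... | no  _ = ∣0-x∣≤1 0≤x x≤1

  count-[]-zero : ∀ e b → ℕ→ℚ (count [] e 0 b) ≡ indicator b
  count-[]-zero e b with ε ≈? b
  ... | yes _ = refl
  ... | no  _ = refl

  -- By linearity the indicator contributes the counts, while a constant is fixed by translation and
  -- so contributes `r` times a binomial coefficient. Including an element is Pascal's rule on both
  -- parts.
  expand-indicator : ∀ r {n} (D : Subset n) e k b →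
    expand (λ b → indicator b - r) D e k b ≡ ℕ→ℚ (count D e k b) - r * binomial (ℕ→ℚ ∣ D ∣) k
  expand-indicator r [] e zero b = cong₂ _-_ (sym (count-[]-zero e b)) (sym (ℚₚ.*-identityʳ r))
  expand-indicator r [] e (suc k) b = sym (begin
    ℕ→ℚ (count [] e (suc k) b) - r * binomial 0ℚ (suc k)
      ≡⟨ cong (λ y → 0ℚ - r * y) (binomial-0-suc k) ⟩
    0ℚ - r * 0ℚ
      ≡⟨ ring r ⟩
    0ℚ
      ∎)
    where
    open ≡-Reasoning
    ring : ∀ r → 0ℚ - r * 0ℚ ≡ 0ℚ
    ring = solve-∀ ℚ-ring
  expand-indicator r (outside ∷ D) e k b = trans (expand-indicator r D (e ∘ suc) k b)
    (cong (λ m → ℕ→ℚ m - r * binomial (ℕ→ℚ ∣ D ∣) k) (sym (count-outside D e k b)))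
  expand-indicator r (inside ∷ D) e zero b = begin
    expand (λ b → indicator b - r) D (e ∘ suc) 0 b + 0ℚ
      ≡⟨ ℚₚ.+-identityʳ _ ⟩
    expand (λ b → indicator b - r) D (e ∘ suc) 0 b
      ≡⟨ expand-indicator r D (e ∘ suc) 0 b ⟩
    ℕ→ℚ (count D (e ∘ suc) 0 b) - r * binomial (ℕ→ℚ ∣ D ∣) 0
      ≡⟨ cong (λ m → ℕ→ℚ m - r * 1ℚ) (count-inside-zero D e b) ⟨
    ℕ→ℚ (count (inside ∷ D) e 0 b) - r * binomial (ℕ→ℚ (suc ∣ D ∣)) 0
      ∎
    where open ≡-Reasoning
  expand-indicator r (inside ∷ D) e (suc k) b = begin
    expand (λ b → indicator b - r) D (e ∘ suc) (suc k) b + expand (λ b → indicator b - r) D (e ∘ suc) k (b // e zero)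
      ≡⟨ cong₂ _+_ (expand-indicator r D (e ∘ suc) (suc k) b) (expand-indicator r D (e ∘ suc) k (b // e zero)) ⟩
    ℕ→ℚ m₁ - r * binomial d (suc k) + (ℕ→ℚ m₂ - r * binomial d k)
      ≡⟨ ring (ℕ→ℚ m₁) (ℕ→ℚ m₂) r (binomial d (suc k)) (binomial d k) ⟩
    ℕ→ℚ m₁ + ℕ→ℚ m₂ - r * (binomial d (suc k) + binomial d k)
      ≡⟨ cong₂ (λ m y → m - r * y) (ℕ→ℚ-+ m₁ m₂) (binomial-pascal d k) ⟨
    ℕ→ℚ (m₁ ℕ.+ m₂) - r * binomial (1ℚ + d) (suc k)
      ≡⟨ cong₂ (λ m y → ℕ→ℚ m - r * binomial y (suc k)) (count-inside-suc D e k b) (ℕ→ℚ-suc ∣ D ∣) ⟨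
    ℕ→ℚ (count (inside ∷ D) e (suc k) b) - r * binomial (ℕ→ℚ (suc ∣ D ∣)) (suc k)
      ∎
    where
    open ≡-Reasoning
    d : ℚ
    d = ℕ→ℚ ∣ D ∣
    m₁ m₂ : ℕ
    m₁ = count D (e ∘ suc) (suc k) b
    m₂ = count D (e ∘ suc) k (b // e zero)
    ring : ∀ u v r x y → u - r * x + (v - r * y) ≡ u + v - r * (x + y)
    ring = solve-∀ ℚ-ring

-- Sums over the whole group

sum-const : ∀ n x → ℚ-Sum.sum {n} (λ _ → x) ≡ ℕ→ℚ n * x
sum-const zero    x = sym (ℚₚ.*-zeroˡ x)
sum-const (suc n) x = begin
  x + ℚ-Sum.sum {n} (λ _ → x)   ≡⟨ cong (λ y → x + y) (sum-const n x) ⟩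
  x + ℕ→ℚ n * x                 ≡⟨ ring x (ℕ→ℚ n) ⟩
  (1ℚ + ℕ→ℚ n) * x              ≡⟨ cong (_* x) (ℕ→ℚ-suc n) ⟨
  ℕ→ℚ (suc n) * x               ∎
  where
  open ≡-Reasoning
  ring : ∀ x n → x + n * x ≡ (1ℚ + n) * x
  ring = solve-∀ ℚ-ring

sum-supported-at : ∀ {n} (f : Fin n → ℚ) i → (∀ j → j ≢ i → f j ≡ 0ℚ) → ℚ-Sum.sum f ≡ f i
sum-supported-at {suc n} f zero    f≡0 = trans
  (cong (λ y → f zero + y) (trans (ℚ-Sum.sum-cong-≗ (λ j → f≡0 (suc j) λ ())) (ℚ-Sum.sum-replicate-zero n)))
  (ℚₚ.+-identityʳ (f zero))
sum-supported-at {suc n} f (suc i) f≡0 = trans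
  (cong₂ _+_ (f≡0 zero λ ()) (sum-supported-at (f ∘ suc) i λ j j≢i → f≡0 (suc j) (j≢i ∘ Finₚ.suc-injective)))
  (ℚₚ.+-identityˡ (f (suc i)))

0≤1/n : ∀ n .{{_ : ℕ.NonZero n}} → 0ℚ ≤ + 1 / n
0≤1/n n = ℚₚ.nonNegative⁻¹ (+ 1 / n) {{ℚₚ.normalize-nonNeg 1 n}}

n*1/n≡1 : ∀ n .{{_ : ℕ.NonZero n}} → ℕ→ℚ n * (+ 1 / n) ≡ 1ℚ
n*1/n≡1 n = ℕ→ℚ-*-/ n 1 1 n 1 (trans (ℕₚ.*-identityʳ (n ℕ.* 1)) (ℕₚ.*-comm n 1))

1/n≤1 : ∀ n .{{_ : ℕ.NonZero n}} → + 1 / n ≤ 1ℚ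
1/n≤1 n = ℕ→ℚ-*-cancelˡ-≤ n (begin
  ℕ→ℚ n * (+ 1 / n)   ≡⟨ n*1/n≡1 n ⟩
  1ℚ                  ≤⟨ ℕ→ℚ-mono-≤ {1} {n} (ℕ.>-nonZero⁻¹ n) ⟩
  ℕ→ℚ n               ≡⟨ ℚₚ.*-identityʳ (ℕ→ℚ n) ⟨
  ℕ→ℚ n * 1ℚ          ∎)
  where open ℚₚ.≤-Reasoning

module GroupSums {a ℓ} (G : FiniteAbelianGroup a ℓ) where
  open FiniteAbelianGroup G renaming (_-_ to _//_; refl to ≈-refl; sym to ≈-sym; trans to ≈-trans) hiding (sum)
  open Inverse enumeration using (to; to-cong; strictlyInverseˡ; strictlyInverseʳ)
  open Families abelianGroup
  open Counting abelianGroup _≈?_ using (indicator; indicator-cong; indicator-yes; indicator-no; ∣indicator-x∣≤1)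
  open import Algebra.Properties.Group group using (//-rightDividesˡ; //-rightDividesʳ; identityʳ-unique)

  module Reindex {c ℓ′} (M : CommutativeMonoid c ℓ′) where
    private
      module M = CommutativeMonoid M
      module Σ = CommutativeMonoidSum M

    -- A bijection of the group turns into a permutation of indices through the enumeration. The
    -- target monoid is arbitrary since sums are taken both in the group itself and in ℚ.
    sum-reindex : (F : Carrier → M.Carrier) → (∀ {x y} → x ≈ y → F x M.≈ F y) →
                  (h h⁻¹ : Carrier → Carrier) →
                  (∀ {x y} → x ≈ y → h x ≈ h y) → (∀ {x y} → x ≈ y → h⁻¹ x ≈ h⁻¹ y) →
                  (∀ x → h (h⁻¹ x) ≈ x) → (∀ x → h⁻¹ (h x) ≈ x) →
                  Σ.sum (λ i → F (h (element i))) M.≈ Σ.sum (λ i → F (element i))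
    sum-reindex F F-cong h h⁻¹ h-cong h⁻¹-cong h∘h⁻¹ h⁻¹∘h = M.sym (M.trans
      (Σ.sum-permute (F ∘ element) π)
      (Σ.sum-cong-≋ (λ i → F-cong (strictlyInverseʳ (h (element i))))))
      where
      onIndices : ∀ {g g⁻¹} → (∀ {x y} → x ≈ y → g x ≈ g y) → (∀ x → g (g⁻¹ x) ≈ x) →
                  ∀ i → to (g (element (to (g⁻¹ (element i))))) ≡ i
      onIndices {g} {g⁻¹} g-cong g∘g⁻¹ i = trans
        (to-cong (≈-trans (g-cong (strictlyInverseʳ (g⁻¹ (element i)))) (g∘g⁻¹ (element i))))
        (strictlyInverseˡ i)
      π : Permutation′ order
      π = mk↔ₛ′ (λ i → to (h (element i))) (λ i → to (h⁻¹ (element i)))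
            (onIndices {h} {h⁻¹} h-cong h∘h⁻¹) (onIndices {h⁻¹} {h} h⁻¹-cong h⁻¹∘h)

  -- Translation by `x` permutes the group, so the sum of all elements is unchanged when `|G|`
  -- copies of `x` are added to it.
  order·x≈ε : ∀ x → order · x ≈ ε
  order·x≈ε x = identityʳ-unique (G-Sum.sum element) (order · x) (begin
    G-Sum.sum element ∙ order · x                      ≈⟨ ∙-congˡ (G-Sum.sum-replicate order) ⟨
    G-Sum.sum element ∙ G-Sum.sum {order} (λ _ → x)    ≈⟨ G-Sum.∑-distrib-+ element (λ _ → x) ⟨
    G-Sum.sum (λ i → element i ∙ x)                    ≈⟨ sum-reindex id id (_∙ x) (_// x) ∙-congʳ ∙-congʳ
                                                    (//-rightDividesˡ x) (//-rightDividesʳ x) ⟩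
    G-Sum.sum element                                  ∎)
    where
    module G-Sum = CommutativeMonoidSum commutativeMonoid
    open Reindex commutativeMonoid
    open SetoidReasoning (AbelianGroup.setoid abelianGroup)

  open Reindex ℚₚ.+-0-commutativeMonoid

  total : (Carrier → ℚ) → ℚ
  total F = ℚ-Sum.sum (λ i → F (element i))

  total-indicator : total indicator ≡ 1ℚ
  total-indicator = trans
    (sum-supported-at (indicator ∘ element) (to ε) λ j j≢ → indicator-no λ ε≈ →
      j≢ (trans (sym (strictlyInverseˡ j)) (to-cong (≈-sym ε≈))))
    (indicator-yes (≈-sym (strictlyInverseʳ ε)))

  deviation : Carrier → ℚ
  deviation b = indicator b - + 1 / order

  deviation-cong : ∀ {x y} → x ≈ y → deviation x ≡ deviation y
  deviation-cong x≈y = cong (λ y → y - + 1 / order) (indicator-cong x≈y)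

  total-deviation : total deviation ≡ 0ℚ
  total-deviation = begin
    total deviation
      ≡⟨ ℚ-Sum.∑-distrib-+ (indicator ∘ element) (λ _ → - (+ 1 / order)) ⟩
    total indicator + ℚ-Sum.sum {order} (λ _ → - (+ 1 / order))
      ≡⟨ cong₂ _+_ total-indicator (sum-const order (- (+ 1 / order))) ⟩
    1ℚ + ℕ→ℚ order * - (+ 1 / order)
      ≡⟨ ring (ℕ→ℚ order) (+ 1 / order) ⟩
    1ℚ - ℕ→ℚ order * (+ 1 / order)
      ≡⟨ cong (λ y → 1ℚ - y) (n*1/n≡1 order) ⟩
    0ℚ
      ∎
    where
    open ≡-Reasoning
    ring : ∀ n x → 1ℚ + n * - x ≡ 1ℚ - n * x
    ring = solve-∀ ℚ-ring

  ∣deviation∣≤1 : ∀ b → ∥ deviation b ∥ ≤ 1ℚ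
  ∣deviation∣≤1 = ∣indicator-x∣≤1 (0≤1/n order) (1/n≤1 order)

  -- Each factor `1 + z x` adds a translate of the previous coefficient, and translation preserves
  -- totals, so zero totals persist.
  total-expand : ∀ {φ} → (∀ {x y} → x ≈ y → φ x ≡ φ y) → total φ ≡ 0ℚ →
                 ∀ {n} (D : Subset n) e k → total (expand φ D e k) ≡ 0ℚ
  total-expand φ-cong ∑φ≡0 []            e zero    = ∑φ≡0
  total-expand φ-cong ∑φ≡0 []            e (suc k) = ℚ-Sum.sum-replicate-zero order
  total-expand φ-cong ∑φ≡0 (outside ∷ D) e k       = total-expand φ-cong ∑φ≡0 D (e ∘ suc) k
  total-expand {φ} φ-cong ∑φ≡0 (inside  ∷ D) e k   = trans
    (ℚ-Sum.∑-distrib-+ (f k ∘ element) (shift (e zero) f k ∘ element))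
    (cong₂ _+_ (total-expand φ-cong ∑φ≡0 D (e ∘ suc) k) (total-shift k))
    where
    f : Family
    f = expand φ D (e ∘ suc)
    total-shift : ∀ k → total (shift (e zero) f k) ≡ 0ℚ
    total-shift zero    = ℚ-Sum.sum-replicate-zero order
    total-shift (suc k) = trans
      (sum-reindex (f k) (expand-cong φ-cong D (e ∘ suc) k) (_// e zero) (_∙ e zero) ∙-congʳ ∙-congʳ
        (//-rightDividesʳ (e zero)) (//-rightDividesˡ (e zero)))
      (total-expand φ-cong ∑φ≡0 D (e ∘ suc) k)

-- Multiplication by integers in a group of prime exponent

module PrimeExponent {a ℓ} (G : FiniteAbelianGroup a ℓ) (p : ℕ) (p-prime : Prime p)
  (p·x≈ε : ∀ x → FiniteAbelianGroup._≈_ G (FiniteAbelianGroup._·_ G p x) (FiniteAbelianGroup.ε G)) where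

  open FiniteAbelianGroup G renaming (_-_ to _//_; refl to ≈-refl; sym to ≈-sym; trans to ≈-trans) hiding (sum)
  open Families abelianGroup
  open GroupSums G
  open Reindex ℚₚ.+-0-commutativeMonoid
  open import Algebra.Properties.Monoid.Mult monoid using (×-congʳ; ×-congˡ; ×-assocˡ)
  open import Algebra.Properties.Group group
    using (inverseʳ-unique; ⁻¹-involutive; ⁻¹-anti-homo-//; //-rightDividesˡ; ⁻¹-anti-homo-∙; ε⁻¹≈ε)
  private
    module ≈-Reasoning = SetoidReasoning (AbelianGroup.setoid abelianGroup)

  multiple·x≈ε : ∀ n x → (n ℕ.* p) · x ≈ ε
  multiple·x≈ε n x = begin
    (n ℕ.* p) · x    ≈⟨ ×-congˡ (ℕₚ.*-comm n p) ⟩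
    (p ℕ.* n) · x    ≈⟨ ×-assocˡ x p n ⟨
    p · (n · x)      ≈⟨ p·x≈ε (n · x) ⟩
    ε                ∎
    where open ≈-Reasoning

  -- Bézout's identity for the coprime pair `p`, `n` gives an inverse modulo `p`, and multiples of
  -- `p` annihilate the group. Over ℕ the identity has two sign cases.
  ·-invertible : ∀ n .{{_ : ℕ.NonZero n}} → n ℕ.< p → ∃ λ m → ∀ x → m · (n · x) ≈ x
  ·-invertible n n<p with coprime-Bézout (prime⇒coprime p-prime n<p)
  ... | Bézout.-+ x y eq = y , λ z → begin
    y · (n · z)              ≈⟨ ×-assocˡ z y n ⟩
    (y ℕ.* n) · z            ≈⟨ ×-congˡ eq ⟨
    z ∙ (x ℕ.* p) · z        ≈⟨ ∙-congˡ (multiple·x≈ε x z) ⟩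
    z ∙ ε                    ≈⟨ identityʳ z ⟩
    z                        ∎
    where open ≈-Reasoning
  -- Here `y * n` is -1 modulo `p`, so its square is 1 and `y * n * y` inverts `n`.
  ... | Bézout.+- x y eq = y ℕ.* n ℕ.* y , λ z → begin
    (y ℕ.* n ℕ.* y) · (n · z)         ≈⟨ ×-assocˡ z (y ℕ.* n ℕ.* y) n ⟩
    (y ℕ.* n ℕ.* y ℕ.* n) · z         ≈⟨ ×-congˡ (ℕₚ.*-assoc (y ℕ.* n) y n) ⟩
    (y ℕ.* n ℕ.* (y ℕ.* n)) · z       ≈⟨ ×-assocˡ z (y ℕ.* n) (y ℕ.* n) ⟨
    (y ℕ.* n) · ((y ℕ.* n) · z)       ≈⟨ negates ((y ℕ.* n) · z) ⟩
    ((y ℕ.* n) · z) ⁻¹                ≈⟨ ⁻¹-cong (negates z) ⟩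
    (z ⁻¹) ⁻¹                         ≈⟨ ⁻¹-involutive z ⟩
    z                                 ∎
    where
    open ≈-Reasoning
    negates : ∀ z → (y ℕ.* n) · z ≈ z ⁻¹
    negates z = inverseʳ-unique z ((y ℕ.* n) · z) (begin
      z ∙ (y ℕ.* n) · z    ≈⟨ ×-congˡ eq ⟩
      (x ℕ.* p) · z        ≈⟨ multiple·x≈ε x z ⟩
      ε                    ∎)

  x//[x//y]≈y : ∀ x y → x // (x // y) ≈ y
  x//[x//y]≈y x y = begin
    x // (x // y)    ≈⟨ ∙-congˡ (⁻¹-anti-homo-// x y) ⟩
    x ∙ (y // x)     ≈⟨ comm x (y // x) ⟩
    (y // x) ∙ x     ≈⟨ //-rightDividesˡ x y ⟩
    y                ∎
    where open ≈-Reasoning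

  -- The map sending `x` to `b - n x` is a bijection, with inverse sending `y` to `m (b - y)` for
  -- `m` inverse to `n`.
  total-· : ∀ F → (∀ {x y} → x ≈ y → F x ≡ F y) → ∀ n .{{_ : ℕ.NonZero n}} → n ℕ.< p →
            ∀ b → total (λ x → F (b // n · x)) ≡ total F
  total-· F F-cong n n<p b with ·-invertible n n<p
  ... | m , m·n·x≈x = sum-reindex F F-cong (λ x → b // n · x) (λ y → m · (b // y))
    (λ x≈y → ∙-congˡ (⁻¹-cong (×-congʳ n x≈y)))
    (λ x≈y → ×-congʳ m (∙-congˡ (⁻¹-cong x≈y)))
    (λ y → ≈-trans (∙-congˡ (⁻¹-cong (≈-trans (·-swap n m (b // y)) (m·n·x≈x (b // y))))) (x//[x//y]≈y b y))
    (λ x → ≈-trans (×-congʳ m (x//[x//y]≈y b (n · x))) (m·n·x≈x x))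
    where
    open ≈-Reasoning
    ·-swap : ∀ n m x → n · (m · x) ≈ m · (n · x)
    ·-swap n m x = begin
      n · (m · x)      ≈⟨ ×-assocˡ x n m ⟩
      (n ℕ.* m) · x    ≈⟨ ×-congˡ (ℕₚ.*-comm n m) ⟩
      (m ℕ.* n) · x    ≈⟨ ×-assocˡ x m n ⟨
      m · (n · x)      ∎

  //-·-suc : ∀ b r x → (b // r · x) // x ≈ b // suc r · x
  //-·-suc b r x = ≈-trans (assoc b _ _) (∙-congˡ (≈-sym (⁻¹-anti-homo-∙ x (r · x))))

  //-p· : ∀ b x → b // p · x ≈ b // 0 · x
  //-p· b x = ∙-congˡ (⁻¹-cong (p·x≈ε x))

  //-0· : ∀ b x → b // 0 · x ≈ b
  //-0· b x = ≈-trans (∙-congˡ ε⁻¹≈ε) (identityʳ b)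

  -- The inductive estimate

  module Estimate
    (D : Subset order) (c m : ℕ) (∣D∣≡c+m : ∣ D ∣ ≡ c ℕ.+ m) (∣∁D∣≡c : ∣ ∁ D ∣ ≡ c)
    (A : ℚ) (pA≡m : ℕ→ℚ p * A ≡ ℕ→ℚ m) (0≤A : 0ℚ ≤ A) (1≤A+c : 1ℚ ≤ A + ℕ→ℚ c)
    (f : Family) (f-cong : Congruent f) (∣f₀∣≤1 : ∀ b → ∥ f 0 b ∥ ≤ 1ℚ)
    (f-newton : ∀ k b → ℕ→ℚ k * f k b ≡ sumOver D (λ i → alternate (element i) f k b))
    (total-f : ∀ k → total (f k) ≡ 0ℚ)
    where

    B R : ℕ → ℚ
    B = multichoose (A + ℕ→ℚ c)
    R = partialSum B

    0≤A+c : 0ℚ ≤ A + ℕ→ℚ c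
    0≤A+c = 0≤+ 0≤A (0≤ℕ→ℚ c)

    0≤B : ∀ k → 0ℚ ≤ B k
    0≤B = 0≤multichoose 0≤A+c

    -- `alternateSum r` is the tail of Newton's alternating sum after `r` steps, up to sign: `r`
    -- records how many copies of each element have been subtracted. Since `p x = ε`, the counter
    -- can be reset to 0 on reaching `p`.
    alternateSum translateSum : ℕ → ℕ → Carrier → ℚ
    alternateSum r k b = sumOver D (λ i → alternate (element i) f k (b // r · element i))
    translateSum r k b = sumOver D (λ i → f k (b // r · element i))

    alternateSum-suc : ∀ r k b → alternateSum r (suc k) b ≡ translateSum (suc r) k b - alternateSum (suc r) k b
    alternateSum-suc r k b = trans
      (sumOver-cong D (λ i → cong₂ _-_
        (f-cong k (//-·-suc b r (element i)))
        (alternate-cong (element i) f-cong k (//-·-suc b r (element i)))))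
      (sumOver-- D _ _)

    alternateSum-p : ∀ k b → alternateSum p k b ≡ alternateSum 0 k b
    alternateSum-p k b = sumOver-cong D (λ i → alternate-cong (element i) f-cong k (//-p· b (element i)))

    alternateSum-0 : ∀ k b → alternateSum 0 k b ≡ ℕ→ℚ k * f k b
    alternateSum-0 k b = trans
      (sumOver-cong D (λ i → alternate-cong (element i) f-cong k (//-0· b (element i))))
      (sym (f-newton k b))

    -- The full translate sum vanishes, so D may be traded for its complement.
    ∣translateSum∣≤ : ∀ k → (∀ b → ∥ f k b ∥ ≤ B k) → ∀ r .{{_ : ℕ.NonZero r}} → r ℕ.< p →
                      ∀ b → ∥ translateSum r k b ∥ ≤ ℕ→ℚ c * B k
    ∣translateSum∣≤ k f≤B r r<p b = begin
      ∥ sumOver D g ∥                                           ≡⟨ cong ∥_∥ (ring (sumOver D g) (sumOver (∁ D) g)) ⟩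
      ∥ sumOver D g + sumOver (∁ D) g - sumOver (∁ D) g ∥       ≡⟨ cong (λ y → ∥ y - sumOver (∁ D) g ∥) sum≡0 ⟩
      ∥ 0ℚ - sumOver (∁ D) g ∥                                  ≡⟨ cong ∥_∥ (ℚₚ.+-identityˡ (- sumOver (∁ D) g)) ⟩
      ∥ - sumOver (∁ D) g ∥                                     ≡⟨ ℚₚ.∣-p∣≡∣p∣ (sumOver (∁ D) g) ⟩
      ∥ sumOver (∁ D) g ∥                                       ≤⟨ ∣sumOver∣≤ (∁ D) g (λ i → f≤B _) ⟩
      ℕ→ℚ ∣ ∁ D ∣ * B k                                         ≡⟨ cong (λ n → ℕ→ℚ n * B k) ∣∁D∣≡c ⟩
      ℕ→ℚ c * B k                                               ∎
      where
      open ℚₚ.≤-Reasoning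
      g : Fin order → ℚ
      g i = f k (b // r · element i)
      ring : ∀ x y → x ≡ x + y - y
      ring = solve-∀ ℚ-ring
      sum≡0 : sumOver D g + sumOver (∁ D) g ≡ 0ℚ
      sum≡0 = trans (sumOver-∁ D g) (trans (total-· (f k) (f-cong k) r r<p b) (total-f k))

    -- In Newton's identity the i-th term has weight c, except that every p-th
    -- one has weight c + m = c + p A; the term A r B averages this excess out.
    ∣alternateSum∣≤ : ∀ k → (∀ j → j ℕ.< k → ∀ b → ∥ f j b ∥ ≤ B j) → ∀ r → r ℕ.< p →
                      ∀ b → ∥ alternateSum r k b ∥ ≤ (A + ℕ→ℚ c) * R k + A * (ℕ→ℚ r * B k)
    ∣alternateSum∣≤ zero    f≤B r r<p b = begin
      ∥ alternateSum r 0 b ∥                    ≡⟨ cong ∥_∥ (sumOver-zero D) ⟩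
      0ℚ                                        ≤⟨ 0≤+ (0≤* 0≤A+c ℚₚ.≤-refl) (0≤* 0≤A (0≤* (0≤ℕ→ℚ r) (0≤B 0))) ⟩
      (A + ℕ→ℚ c) * R 0 + A * (ℕ→ℚ r * B 0)     ∎
      where open ℚₚ.≤-Reasoning
    ∣alternateSum∣≤ (suc k) f≤B r r<p b = begin
      ∥ alternateSum r (suc k) b ∥
        ≡⟨ cong ∥_∥ (alternateSum-suc r k b) ⟩
      ∥ translateSum (suc r) k b - alternateSum (suc r) k b ∥
        ≤⟨ ℚₚ.∣p-q∣≤∣p∣+∣q∣ (translateSum (suc r) k b) (alternateSum (suc r) k b) ⟩
      ∥ translateSum (suc r) k b ∥ + ∥ alternateSum (suc r) k b ∥
        ≤⟨ step (ℕₚ.m≤n⇒m<n∨m≡n r<p) ⟩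
      (A + ℕ→ℚ c) * (R k + B k) + A * (ℕ→ℚ r * B k)
        -- The slack was measured with `B k` but the claim has `B (suc k)`; this is where
        -- monotonicity of `B` is used.
        ≤⟨ ℚₚ.+-monoʳ-≤ ((A + ℕ→ℚ c) * (R k + B k)) (*-monoˡ 0≤A (*-monoˡ (0≤ℕ→ℚ r) (multichoose-mono 1≤A+c k))) ⟩
      (A + ℕ→ℚ c) * R (suc k) + A * (ℕ→ℚ r * B (suc k))
        ∎
      where
      open ℚₚ.≤-Reasoning
      ih : ∀ r → r ℕ.< p → ∀ b → ∥ alternateSum r k b ∥ ≤ (A + ℕ→ℚ c) * R k + A * (ℕ→ℚ r * B k)
      ih = ∣alternateSum∣≤ k (λ j j<k → f≤B j (ℕₚ.m<n⇒m<1+n j<k))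
      ring₁ : ∀ A c r R B → c * B + ((A + c) * R + A * ((1ℚ + r) * B)) ≡ (A + c) * (R + B) + A * (r * B)
      ring₁ = solve-∀ ℚ-ring
      ring₂ : ∀ A c r R B → (c + (1ℚ + r) * A) * B + ((A + c) * R + A * (0ℚ * B)) ≡ (A + c) * (R + B) + A * (r * B)
      ring₂ = solve-∀ ℚ-ring
      ∣D∣≡ : suc r ≡ p → ℕ→ℚ ∣ D ∣ ≡ ℕ→ℚ c + (1ℚ + ℕ→ℚ r) * A
      ∣D∣≡ 1+r≡p = trans (cong ℕ→ℚ ∣D∣≡c+m) (trans (ℕ→ℚ-+ c m) (cong (λ y → ℕ→ℚ c + y)
        (trans (sym pA≡m) (cong (_* A) (trans (cong ℕ→ℚ (sym 1+r≡p)) (ℕ→ℚ-suc r))))))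
      step : suc r ℕ.< p ⊎ suc r ≡ p → ∥ translateSum (suc r) k b ∥ + ∥ alternateSum (suc r) k b ∥ ≤
             (A + ℕ→ℚ c) * (R k + B k) + A * (ℕ→ℚ r * B k)
      -- The translate sum costs only `c`; one `A` from the slack `A (1 + r)` tops this up to the
      -- average weight `A + c`, leaving slack `A r`.
      step (inj₁ 1+r<p) = begin
        ∥ translateSum (suc r) k b ∥ + ∥ alternateSum (suc r) k b ∥
          ≤⟨ ℚₚ.+-mono-≤ (∣translateSum∣≤ k (f≤B k (ℕₚ.n<1+n k)) (suc r) 1+r<p b) (ih (suc r) 1+r<p b) ⟩
        ℕ→ℚ c * B k + ((A + ℕ→ℚ c) * R k + A * (ℕ→ℚ (suc r) * B k))
          ≡⟨ cong (λ y → ℕ→ℚ c * B k + ((A + ℕ→ℚ c) * R k + A * (y * B k))) (ℕ→ℚ-suc r) ⟩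
        ℕ→ℚ c * B k + ((A + ℕ→ℚ c) * R k + A * ((1ℚ + ℕ→ℚ r) * B k))
          ≡⟨ ring₁ A (ℕ→ℚ c) (ℕ→ℚ r) (R k) (B k) ⟩
        (A + ℕ→ℚ c) * (R k + B k) + A * (ℕ→ℚ r * B k)
          ∎
      -- Translation by `p x` is trivial, so there is no cancellation and all of `|D| = c + p A` is
      -- paid. With `r = p - 1` the allowance `(A + c) + A r` covers it exactly, and the counter
      -- restarts at 0 with no slack.
      step (inj₂ 1+r≡p) = begin
        ∥ translateSum (suc r) k b ∥ + ∥ alternateSum (suc r) k b ∥
          ≡⟨ cong (λ y → ∥ translateSum (suc r) k b ∥ + ∥ y ∥)
               (trans (cong (λ n → alternateSum n k b) 1+r≡p) (alternateSum-p k b)) ⟩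
        ∥ translateSum (suc r) k b ∥ + ∥ alternateSum 0 k b ∥
          ≤⟨ ℚₚ.+-mono-≤ (∣sumOver∣≤ D _ (λ i → f≤B k (ℕₚ.n<1+n k) _)) (ih 0 (ℕₚ.m<n⇒0<n r<p) b) ⟩
        ℕ→ℚ ∣ D ∣ * B k + ((A + ℕ→ℚ c) * R k + A * (0ℚ * B k))
          ≡⟨ cong (λ y → y * B k + ((A + ℕ→ℚ c) * R k + A * (0ℚ * B k))) (∣D∣≡ 1+r≡p) ⟩
        (ℕ→ℚ c + (1ℚ + ℕ→ℚ r) * A) * B k + ((A + ℕ→ℚ c) * R k + A * (0ℚ * B k))
          ≡⟨ ring₂ A (ℕ→ℚ c) (ℕ→ℚ r) (R k) (B k) ⟩
        (A + ℕ→ℚ c) * (R k + B k) + A * (ℕ→ℚ r * B k)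
          ∎

    ∣f∣≤B-step : ∀ k → (∀ {j} → j ℕ.< k → ∀ b → ∥ f j b ∥ ≤ B j) → ∀ b → ∥ f k b ∥ ≤ B k
    -- `B 0` computes to `1ℚ`.
    ∣f∣≤B-step zero    f≤B b = ∣f₀∣≤1 b
    ∣f∣≤B-step (suc k) f≤B b = ℕ→ℚ-*-cancelˡ-≤ (suc k) (begin
        ℕ→ℚ (suc k) * ∥ f (suc k) b ∥
          ≡⟨ cong (_* ∥ f (suc k) b ∥) (ℚₚ.0≤p⇒∣p∣≡p (0≤ℕ→ℚ (suc k))) ⟨
        ∥ ℕ→ℚ (suc k) ∥ * ∥ f (suc k) b ∥
          ≡⟨ ℚₚ.∣p*q∣≡∣p∣*∣q∣ (ℕ→ℚ (suc k)) (f (suc k) b) ⟨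
        ∥ ℕ→ℚ (suc k) * f (suc k) b ∥
          ≡⟨ cong ∥_∥ (alternateSum-0 (suc k) b) ⟨
        ∥ alternateSum 0 (suc k) b ∥
          -- Starting at `r = 0` removes the slack term, so what remains is the recursion satisfied
          -- by `B` itself.
          ≤⟨ ∣alternateSum∣≤ (suc k) (λ j → f≤B) 0 (ℕ.>-nonZero⁻¹ p {{prime⇒nonZero p-prime}}) b ⟩
        (A + ℕ→ℚ c) * R (suc k) + A * (0ℚ * B (suc k))
          ≡⟨ ring ((A + ℕ→ℚ c) * R (suc k)) A (B (suc k)) ⟩
        (A + ℕ→ℚ c) * R (suc k)
          ≡⟨ multichoose-partialSum (A + ℕ→ℚ c) (suc k) ⟨
        ℕ→ℚ (suc k) * B (suc k)
          ∎)
      where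
      open ℚₚ.≤-Reasoning
      ring : ∀ x a b → x + a * (0ℚ * b) ≡ x
      ring = solve-∀ ℚ-ring

    ∣f∣≤B : ∀ k b → ∥ f k b ∥ ≤ B k
    ∣f∣≤B = <-rec (λ k → ∀ b → ∥ f k b ∥ ≤ B k) ∣f∣≤B-step

-- Specialisation of the estimate to the subset-sum counts

corollary1p2 : ∀ {a ℓ} (p : ℕ) (p-prime : Prime p) (G : FiniteAbelianGroup a ℓ) →
    let open FiniteAbelianGroup G in
    IsElementaryAbelian p → HasExponent p →
    (D : Subset order) (c : ℕ) → + ∣ D ∣ ≡ + order ℤ.- + c → c ℕ.≤ ∣ D ∣ →
    (b : Carrier) (k : ℕ) → k ℕ.≤ ∣ D ∣ →
    ℚ.∣ ℕ→ℚ (N D k b) ℚ.- (+ 1 / order) ℚ.* binomial (ℕ→ℚ order ℚ.- ℕ→ℚ c) k ∣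
    ℚ.≤
    binomial (((+ order ℤ.- + (2 ℕ.* c)) / p) {{prime⇒nonZero p-prime}} ℚ.+ ℕ→ℚ c ℚ.+ ℕ→ℚ k ℚ.- 1ℚ) k
corollary1p2 p p-prime G _ (_ , p·x≈ε , p-minimal) D c ∣D∣≡order-c c≤∣D∣ b k _ = begin
  ∥ ℕ→ℚ (N D k b) - (+ 1 / order) * binomial (ℕ→ℚ order - ℕ→ℚ c) k ∥
    ≡⟨ cong (λ x → ∥ ℕ→ℚ (N D k b) - (+ 1 / order) * binomial x k ∥) order-c≡∣D∣ ⟩
  ∥ ℕ→ℚ (N D k b) - (+ 1 / order) * binomial (ℕ→ℚ ∣ D ∣) k ∥
    -- For the tuple `element`, `count` unfolds to `N`.
    ≡⟨ cong ∥_∥ (expand-indicator (+ 1 / order) D element k b) ⟨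
  ∥ expand deviation D element k b ∥
    ≤⟨ ∣f∣≤B k b ⟩
  multichoose (+ m / p + ℕ→ℚ c) k
    ≡⟨ cong (λ i → multichoose (i / p + ℕ→ℚ c) k) order-2c≡m ⟨
  multichoose ((+ order ℤ.- + (2 ℕ.* c)) / p + ℕ→ℚ c) k
    ∎
  where
  open FiniteAbelianGroup G using (order; order-nonZero; element; N; abelianGroup; _≈?_)
  open Families abelianGroup using (expand; expand-cong; expand-zero; newton)
  open Counting abelianGroup _≈?_ using (expand-indicator)
  open GroupSums G
  open PrimeExponent G p p-prime p·x≈ε using (module Estimate)
  open ℚₚ.≤-Reasoning
  instance
    p-nonZero : ℕ.NonZero p
    p-nonZero = prime⇒nonZero p-prime
  -- `m` equals `|G| - 2c`; truncated subtraction is exact because `c ≤ |D|`, and therefore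
  -- `A = m/p` is nonnegative.
  m : ℕ
  m = ∣ D ∣ ℕ.∸ c
  ∣D∣≡c+m : ∣ D ∣ ≡ c ℕ.+ m
  ∣D∣≡c+m = sym (ℕₚ.m+[n∸m]≡n c≤∣D∣)
  order≡∣D∣+c : order ≡ ∣ D ∣ ℕ.+ c
  order≡∣D∣+c = ℤₚ.+-injective (sym (trans (cong (ℤ._+ + c) ∣D∣≡order-c) (ring (+ order) (+ c))))
    where
    ring : ∀ i j → i ℤ.- j ℤ.+ j ≡ i
    ring = ℤ-Solver.solve-∀
  order-c≡∣D∣ : ℕ→ℚ order - ℕ→ℚ c ≡ ℕ→ℚ ∣ D ∣
  order-c≡∣D∣ = trans
    (cong (λ x → x - ℕ→ℚ c) (trans (cong ℕ→ℚ order≡∣D∣+c) (ℕ→ℚ-+ ∣ D ∣ c)))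
    (ring (ℕ→ℚ ∣ D ∣) (ℕ→ℚ c))
    where
    ring : ∀ x y → x + y - y ≡ x
    ring = solve-∀ ℚ-ring
  order-2c≡m : + order ℤ.- + (2 ℕ.* c) ≡ + m
  order-2c≡m = trans
    (cong (λ n → + n ℤ.- + (2 ℕ.* c)) (trans order≡∣D∣+c (cong (ℕ._+ c) ∣D∣≡c+m)))
    (ring (+ c) (+ m))
    where
    -- `2 ℕ.* c` unfolds to `c + (c + 0)`, which explains the trailing zero.
    ring : ∀ i j → i ℤ.+ j ℤ.+ i ℤ.- (i ℤ.+ (i ℤ.+ + 0)) ≡ j
    ring = ℤ-Solver.solve-∀
  ∣∁D∣≡c : ∣ ∁ D ∣ ≡ c
  ∣∁D∣≡c = trans (∣∁p∣≡n∸∣p∣ D) (trans (cong (ℕ._∸ ∣ D ∣) order≡∣D∣+c) (ℕₚ.m+n∸m≡n ∣ D ∣ c))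
  pA≡m : ℕ→ℚ p * (+ m / p) ≡ ℕ→ℚ m
  pA≡m = ℕ→ℚ-*-/ p m m p 1 (trans (ℕₚ.*-identityʳ (p ℕ.* m)) (ℕₚ.*-comm p m))
  0≤A : 0ℚ ≤ + m / p
  0≤A = ℚₚ.nonNegative⁻¹ (+ m / p) {{ℚₚ.normalize-nonNeg m p}}
  1≤A+c : 1ℚ ≤ + m / p + ℕ→ℚ c
  -- For `c = 0` the claim becomes `p ≤ |G|`: the order annihilates every element, so it is at least
  -- the exponent `p`.
  1≤A+c = 1≤x+n c 0≤A λ c≡0 → ℕ→ℚ-*-cancelˡ-≤ p (begin
    ℕ→ℚ p * 1ℚ           ≡⟨ ℚₚ.*-identityʳ (ℕ→ℚ p) ⟩
    ℕ→ℚ p                ≤⟨ ℕ→ℚ-mono-≤ (p-minimal order (ℕ.>-nonZero⁻¹ order) order·x≈ε) ⟩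
    ℕ→ℚ order            ≡⟨ cong ℕ→ℚ (trans order≡∣D∣+c (cong₂ ℕ._+_ (trans ∣D∣≡c+m (cong (ℕ._+ m) c≡0)) c≡0)) ⟩
    ℕ→ℚ (m ℕ.+ 0)        ≡⟨ cong ℕ→ℚ (ℕₚ.+-identityʳ m) ⟩
    ℕ→ℚ m                ≡⟨ pA≡m ⟨
    ℕ→ℚ p * (+ m / p)    ∎)
  open Estimate D c m ∣D∣≡c+m ∣∁D∣≡c (+ m / p) pA≡m 0≤A 1≤A+c
    (expand deviation D element) (expand-cong deviation-cong D element)
    (λ b → ℚₚ.≤-trans (ℚₚ.≤-reflexive (cong ∥_∥ (expand-zero deviation D element b))) (∣deviation∣≤1 b))
    (newton deviation-cong D element)
    (total-expand deviation-cong total-deviation D element)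
    using (∣f∣≤B)
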